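{- Let $f$ be a nonnegative, nonzero integral flow on an oriented signed graph $(\Sigma,\omega)$ such that $\Sigma(f)$ is connected. Then there exists a closed walk $W$ on $\Sigma(f)$ of positive sign such that, with each occurrence of an edge oriented by $\omega$, $(W,\omega)$ is a directed closed positive walk, and $f_W=f$.
   Context: Signed graph: finite graph (loops, multiple edges allowed) with edge signs $\sigma(e)\in\{\pm1\}$; each edge has two ends $(u,e),(v,e)$ (a loop has two distinct ends). An orientation assigns $\omega(v,e)\in\{\pm1\}$ to edge ends with $\sigma(e)=-\omega(u,e)\omega(v,e)$. A walk $W=v_0e_1\cdots e_nv_n$ has sign $\prod\sigma(e_i)$, is closed if $n\ge1$, $v_0=v_n$. A direction of $W$ is an assignment of orientations to the occurrences $e_i$ such that $\omega(v_i,e_i)\omega(v_i,e_{i+1})=-1$ at each internal vertex $v_i$ (using the ends at $v_i$ traversed by the walk); a directed closed positive walk is a closed walk of sign $+1$ with a direction. $f_W(e)$ is the number of indices $i$ with $e_i=e$. Boundary: $\partial g(v)=\sum_{(v,e)}\omega(v,e)g(e)$ over edge ends at $v$; integral flow: $\partial f\equiv0$; $\Sigma(f)$ is the subgraph of edges with $f(e)\ne0$ and their endpoints. -}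

module Defs where

open import Data.Nat using (ℕ; zero; suc)
open import Data.Fin using (Fin)
open import Data.Bool using (Bool; true; false; not)
open import Data.List using (List; []; _∷_)
open import Data.Product using (Σ; ∃; _×_; _,_; proj₁; proj₂)
open import Data.Unit using (⊤)
open import Data.Empty using (⊥)
open import Data.Integer as ℤ using (ℤ; 0ℤ)
open import Data.Sign as S using (Sign)
open import Relation.Nullary using (¬_; Dec; yes; no)
open import Relation.Binary.PropositionalEquality using (_≡_)
open import Data.Fin using (_≟_)

-- A finite signed graph: vertices Fin n, edges Fin m.  Every edge e has two
-- ends, indexed by Bool; (e , b) is an edge end, lying at vertex ends e b.
-- A loop is an edge whose two ends lie at the same vertex (still distinct ends).
-- Multiple edges are allowed (distinct edge indices with the same ends).
record SignedGraph : Set where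
  field
    nV   : ℕ
    nE   : ℕ
    ends : Fin nE → Bool → Fin nV
    sgn  : Fin nE → Sign
open SignedGraph public

-- Orientation: ω assigns a sign to each edge end, with σ(e) = - ω(u,e) ω(v,e).
record Orientation (G : SignedGraph) : Set where
  field
    ω     : Fin (nE G) → Bool → Sign
    valid : ∀ e → sgn G e ≡ S.opposite (ω e false S.* ω e true)
open Orientation public

signℤ : Sign → ℤ
signℤ S.+ = ℤ.+ 1
signℤ S.- = ℤ.-[1+ 0 ]

sumFin : (k : ℕ) → (Fin k → ℤ) → ℤ
sumFin zero    g = 0ℤ
sumFin (suc k) g = g Fin.zero ℤ.+ sumFin k (λ i → g (Fin.suc i))

-- contribution of the edge end (e , b) to the boundary at v
endContrib : (G : SignedGraph) → Orientation G → (Fin (nE G) → ℤ) →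
             Fin (nV G) → Fin (nE G) → Bool → ℤ
endContrib G O g v e b with ends G e b ≟ v
... | yes _ = signℤ (ω O e b) ℤ.* g e
... | no  _ = 0ℤ

-- ∂g(v) = Σ_{edge ends (v,e)} ω(v,e) g(e)
boundary : (G : SignedGraph) → Orientation G → (Fin (nE G) → ℤ) → Fin (nV G) → ℤ
boundary G O g v =
  sumFin (nE G) (λ e → endContrib G O g v e false ℤ.+ endContrib G O g v e true)

IsFlow : (G : SignedGraph) → Orientation G → (Fin (nE G) → ℤ) → Set
IsFlow G O f = ∀ v → boundary G O f v ≡ 0ℤ

----------------------------------------------------------------------
-- Walks.  A walk v₀ e₁ v₁ … eₙ vₙ is a start vertex v₀ and a list of steps
-- (eᵢ , bᵢ): step i leaves v_{i-1} through end bᵢ of eᵢ and arrives at vᵢ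
-- through the other end (not bᵢ) of eᵢ.  This records which end is used,
-- which matters for loops.
Step : SignedGraph → Set
Step G = Fin (nE G) × Bool

tailV : (G : SignedGraph) → Step G → Fin (nV G)
tailV G (e , b) = ends G e b

headV : (G : SignedGraph) → Step G → Fin (nV G)
headV G (e , b) = ends G e (not b)

IsWalkFrom : (G : SignedGraph) → Fin (nV G) → List (Step G) → Set
IsWalkFrom G v []       = ⊤
IsWalkFrom G v (s ∷ ss) = tailV G s ≡ v × IsWalkFrom G (headV G s) ss

endVertex : (G : SignedGraph) → Fin (nV G) → List (Step G) → Fin (nV G)
endVertex G v []       = v
endVertex G v (s ∷ ss) = endVertex G (headV G s) ss

NonEmpty : {A : Set} → List A → Set
NonEmpty []      = ⊥
NonEmpty (_ ∷ _) = ⊤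

IsClosedWalk : (G : SignedGraph) → Fin (nV G) → List (Step G) → Set
IsClosedWalk G v ss = IsWalkFrom G v ss × NonEmpty ss × endVertex G v ss ≡ v

walkSign : (G : SignedGraph) → List (Step G) → Sign
walkSign G []             = S.+
walkSign G ((e , _) ∷ ss) = sgn G e S.* walkSign G ss

-- Direction given by ω on every occurrence: at each internal vertex vᵢ
-- (0 < i < n), ω(vᵢ,eᵢ) ω(vᵢ,eᵢ₊₁) = -1, using the ends traversed.
DirectedBy : (G : SignedGraph) → Orientation G → List (Step G) → Set
DirectedBy G O []                                  = ⊤
DirectedBy G O (_ ∷ [])                            = ⊤
DirectedBy G O ((e , b) ∷ (e' , b') ∷ ss) =
  (ω O e (not b) S.* ω O e' b' ≡ S.-) × DirectedBy G O ((e' , b') ∷ ss)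

-- f_W(e): number of occurrences of e in the walk
occ : (G : SignedGraph) → List (Step G) → Fin (nE G) → ℕ
occ G []             e = 0
occ G ((e' , _) ∷ ss) e with e' ≟ e
... | yes _ = suc (occ G ss e)
... | no  _ = occ G ss e

AllEdgesIn : (G : SignedGraph) → (Fin (nE G) → Set) → List (Step G) → Set
AllEdgesIn G P []             = ⊤
AllEdgesIn G P ((e , _) ∷ ss) = P e × AllEdgesIn G P ss

----------------------------------------------------------------------
-- The support subgraph Σ(f): edges with f(e) ≠ 0 and their endpoints.
InSuppE : (G : SignedGraph) → (Fin (nE G) → ℤ) → Fin (nE G) → Set
InSuppE G f e = ¬ (f e ≡ 0ℤ)

InSuppV : (G : SignedGraph) → (Fin (nE G) → ℤ) → Fin (nV G) → Set
InSuppV G f v = Σ (Fin (nE G)) λ e → Σ Bool λ b → InSuppE G f e × ends G e b ≡ v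

-- Σ(f) is connected: any two of its vertices are joined by a walk in Σ(f).
SuppConnected : (G : SignedGraph) → (Fin (nE G) → ℤ) → Set
SuppConnected G f =
  ∀ u v → InSuppV G f u → InSuppV G f v →
  Σ (List (Step G)) λ ss →
    IsWalkFrom G u ss × endVertex G u ss ≡ v × AllEdgesIn G (InSuppE G f) ss

-- Along a walk keep track of a port (v , s): the current vertex together with the orientation s of
-- the edge end through which the walk entered it; the walk is directed when every edge leaves through
-- an end oriented -s.  The edge-count vector of a directed walk from port (v , s) to port (w , t) has
-- boundary -s δ_v + t δ_w, and the walk has sign s t.  So a closed directed walk is positive and its
-- count vector is a flow.  Inside a nonnegative flow r, a directed walk T that has not returned to its
-- initial port leaves a residual r - f_T with nonzero boundary at its end, which forces an unused edge
-- leaving the end port in the right direction; extending greedily, the walk must close up.  Starting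
-- from a closed directed walk W with f_W ≤ f, as long as f_W ≠ f connectivity of Σ(f) yields an edge
-- of positive residual at a vertex of W; the residual is a flow, so it contains a closed directed walk
-- through that edge, which, reversed if its arrival sign is wrong, is spliced into W.

module Submission where

open import Defs
open import Data.Fin using (Fin)
open import Data.List using (List)
open import Data.Product using (Σ; _×_)
open import Data.Integer using (ℤ; 0ℤ; _≤_; +_)
open import Data.Sign as S using (Sign)
open import Relation.Nullary using (¬_)
open import Relation.Binary.PropositionalEquality using (_≡_)

open import Data.Bool using (Bool; true; false; not)
open import Data.Bool.Properties using (not-involutive)
open import Data.Empty using (⊥-elim)
open import Data.Fin using (zero; suc; _≟_; punchIn)
open import Data.Fin.Properties using (punchInᵢ≢i; any?)
open import Data.List using ([]; _∷_; _++_; _∷ʳ_; [_])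
open import Data.List.Properties using (∷ʳ-++)
open import Data.Nat as ℕ using (ℕ; _∸_)
open import Data.Nat.Properties as ℕ using ()
open import Data.Nat.Induction as ℕ using ()
open import Data.Integer as ℤ using (_+_; _*_; -_; _<_)
open import Data.Integer.Properties as ℤ using ()
open import Data.Product using (∃; ∃₂; _,_; proj₁; proj₂; map)
open import Data.Product.Properties using (≡-dec)
open import Data.Sign.Properties as S using ()
open import Data.Sum using (_⊎_; inj₁; inj₂)
open import Data.Unit using (tt)
open import Function using (_∘_; id)
open import Induction.WellFounded using (Acc; acc)
open import Relation.Nullary using (yes; no)
open import Relation.Binary.PropositionalEquality
  using (refl; sym; trans; cong; cong₂; subst; _≢_; module ≡-Reasoning)

import Algebra.Properties.Semiring.Sum ℤ.+-*-semiring as ℤΣ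
import Algebra.Properties.Monoid.Sum ℕ.+-0-monoid as ℕΣ
open import Algebra.Properties.AbelianGroup ℤ.+-0-abelianGroup using (inverseˡ-unique)

sumFin≡sum : ∀ k (g : Fin k → ℤ) → sumFin k g ≡ ℤΣ.sum g
sumFin≡sum ℕ.zero    g = refl
sumFin≡sum (ℕ.suc k) g = cong (_+_ (g zero)) (sumFin≡sum k (g ∘ suc))

sum-δ : ∀ {n} (g : Fin n → ℤ) j → (∀ i → i ≢ j → g i ≡ 0ℤ) → ℤΣ.sum g ≡ g j
sum-δ {ℕ.suc n} g j vanish = begin
  ℤΣ.sum g                       ≡⟨ ℤΣ.sum-remove {i = j} g ⟩
  g j + ℤΣ.sum (g ∘ punchIn j)   ≡⟨ cong (_+_ (g j)) rest≡0 ⟩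
  g j + 0ℤ                       ≡⟨ ℤ.+-identityʳ (g j) ⟩
  g j                            ∎
  where
  open ≡-Reasoning
  rest≡0 : ℤΣ.sum (g ∘ punchIn j) ≡ 0ℤ
  rest≡0 = trans (ℤΣ.sum-cong-≗ (λ i → vanish (punchIn j i) (punchInᵢ≢i j i))) (ℤΣ.sum-replicate-zero n)

positive-summand : ∀ a b → 0ℤ < a + b → 0ℤ < a ⊎ 0ℤ < b
positive-summand a b 0<a+b with 0ℤ ℤ.<? a | 0ℤ ℤ.<? b
... | yes 0<a | _       = inj₁ 0<a
... | no _    | yes 0<b = inj₂ 0<b
... | no 0≮a  | no 0≮b  = ⊥-elim (ℤ.<⇒≱ 0<a+b (ℤ.+-mono-≤ (ℤ.≮⇒≥ 0≮a) (ℤ.≮⇒≥ 0≮b)))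

sum-positive : ∀ {n} (g : Fin n → ℤ) → 0ℤ < ℤΣ.sum g → ∃ λ i → 0ℤ < g i
sum-positive {ℕ.zero}  g (ℤ.+<+ ())
sum-positive {ℕ.suc n} g 0<sum with positive-summand (g zero) (ℤΣ.sum (g ∘ suc)) 0<sum
... | inj₁ 0<head = zero , 0<head
... | inj₂ 0<rest = map suc id (sum-positive (g ∘ suc) 0<rest)

sum-mono-≤ : ∀ {n} {g h : Fin n → ℕ} → (∀ i → g i ℕ.≤ h i) → ℕΣ.sum g ℕ.≤ ℕΣ.sum h
sum-mono-≤ {ℕ.zero}  g≤h = ℕ.z≤n
sum-mono-≤ {ℕ.suc n} g≤h = ℕ.+-mono-≤ (g≤h zero) (sum-mono-≤ (g≤h ∘ suc))

sum-mono-< : ∀ {n} {g h : Fin n → ℕ} → (∀ i → g i ℕ.≤ h i) → ∀ j → g j ℕ.< h j → ℕΣ.sum g ℕ.< ℕΣ.sum h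
sum-mono-< g≤h zero    gj<hj = ℕ.+-mono-<-≤ gj<hj (sum-mono-≤ (g≤h ∘ suc))
sum-mono-< g≤h (suc j) gj<hj = ℕ.+-mono-≤-< (g≤h zero) (sum-mono-< (g≤h ∘ suc) j gj<hj)

bool-cover : ∀ {ℓ} (P : Bool → Set ℓ) b → P b → P (not b) → ∀ c → P c
bool-cover P false Pb Pnb false = Pb
bool-cover P false Pb Pnb true  = Pnb
bool-cover P true  Pb Pnb false = Pnb
bool-cover P true  Pb Pnb true  = Pb

module DirectedWalks (G : SignedGraph) (O : Orientation G) where

  Vertex : Set
  Vertex = Fin (nV G)

  Edge : Set
  Edge = Fin (nE G)

  Walk : Set
  Walk = List (Step G)

  Port : Set
  Port = Vertex × Sign

  endPort : Edge → Bool → Port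
  endPort e b = ends G e b , ω O e b

  oppositePort : Port → Port
  oppositePort (v , s) = v , S.opposite s

  oppositePort-involutive : ∀ p → oppositePort (oppositePort p) ≡ p
  oppositePort-involutive (v , s) = cong (v ,_) (S.opposite-involutive s)

  DirectedWalk : Port → Walk → Port → Set
  DirectedWalk p []             q = p ≡ q
  DirectedWalk p ((e , b) ∷ W) q = endPort e b ≡ oppositePort p × DirectedWalk (endPort e (not b)) W q

  directedWalk-++ : ∀ {p q r} A {B} → DirectedWalk p A q → DirectedWalk q B r → DirectedWalk p (A ++ B) r
  directedWalk-++ []            refl         dB = dB
  directedWalk-++ ((e , b) ∷ A) (leave , dA) dB = leave , directedWalk-++ A dA dB

  directedWalk-++⁻ : ∀ {p r} A {B} → DirectedWalk p (A ++ B) r →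
                     ∃ λ q → DirectedWalk p A q × DirectedWalk q B r
  directedWalk-++⁻ []            dAB           = _ , refl , dAB
  directedWalk-++⁻ ((e , b) ∷ A) (leave , dAB) =
    let q , dA , dB = directedWalk-++⁻ A dAB in q , (leave , dA) , dB

  reverseWalk : Walk → Walk
  reverseWalk []            = []
  reverseWalk ((e , b) ∷ W) = reverseWalk W ∷ʳ (e , not b)

  directedWalk-reverse : ∀ {p q} W → DirectedWalk p W q →
                         DirectedWalk (oppositePort q) (reverseWalk W) (oppositePort p)
  directedWalk-reverse []            refl        = refl
  directedWalk-reverse ((e , b) ∷ W) (leave , d) =
    directedWalk-++ (reverseWalk W) (directedWalk-reverse W d)
      (sym (oppositePort-involutive (endPort e (not b))) , trans (cong (endPort e) (not-involutive b)) leave)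

  nonEmpty-∷ʳ : ∀ A (x : Step G) → NonEmpty (A ∷ʳ x)
  nonEmpty-∷ʳ []      x = tt
  nonEmpty-∷ʳ (_ ∷ _) x = tt

  nonEmpty-++ : ∀ (A : Walk) {B} → NonEmpty A → NonEmpty (A ++ B)
  nonEmpty-++ (_ ∷ _) _ = tt

  nonEmpty-reverse : ∀ W → NonEmpty W → NonEmpty (reverseWalk W)
  nonEmpty-reverse ((e , b) ∷ W) _ = nonEmpty-∷ʳ (reverseWalk W) (e , not b)

  directedWalk⇒isWalk : ∀ {v s q} W → DirectedWalk (v , s) W q → IsWalkFrom G v W
  directedWalk⇒isWalk []            _           = tt
  directedWalk⇒isWalk ((e , b) ∷ W) (leave , d) = cong proj₁ leave , directedWalk⇒isWalk W d

  directedWalk-endVertex : ∀ {v s q} W → DirectedWalk (v , s) W q → endVertex G v W ≡ proj₁ q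
  directedWalk-endVertex []            refl    = refl
  directedWalk-endVertex ((e , b) ∷ W) (_ , d) = directedWalk-endVertex W d

  directedWalk⇒directedBy : ∀ {p q} W → DirectedWalk p W q → DirectedBy G O W
  directedWalk⇒directedBy []                        _               = tt
  directedWalk⇒directedBy (_ ∷ [])                  _               = tt
  directedWalk⇒directedBy ((e , b) ∷ (e′ , b′) ∷ W) (_ , leave , d) =
    trans (cong (ω O e (not b) S.*_) (cong proj₂ leave)) (S.s*opposite[s]≡- (ω O e (not b))) ,
    directedWalk⇒directedBy ((e′ , b′) ∷ W) (leave , d)

  sgn≡opposite[ω*ω] : ∀ e b → sgn G e ≡ S.opposite (ω O e b S.* ω O e (not b))
  sgn≡opposite[ω*ω] e false = valid O e
  sgn≡opposite[ω*ω] e true  = trans (valid O e) (cong S.opposite (S.*-comm (ω O e false) (ω O e true)))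

  private
    opposite[opposite[s]*h]*[h*t]≡s*t : ∀ s h t → S.opposite (S.opposite s S.* h) S.* (h S.* t) ≡ s S.* t
    opposite[opposite[s]*h]*[h*t]≡s*t S.+ S.+ S.+ = refl
    opposite[opposite[s]*h]*[h*t]≡s*t S.+ S.+ S.- = refl
    opposite[opposite[s]*h]*[h*t]≡s*t S.+ S.- S.+ = refl
    opposite[opposite[s]*h]*[h*t]≡s*t S.+ S.- S.- = refl
    opposite[opposite[s]*h]*[h*t]≡s*t S.- S.+ S.+ = refl
    opposite[opposite[s]*h]*[h*t]≡s*t S.- S.+ S.- = refl
    opposite[opposite[s]*h]*[h*t]≡s*t S.- S.- S.+ = refl
    opposite[opposite[s]*h]*[h*t]≡s*t S.- S.- S.- = refl

  directedWalk-sign : ∀ {p q} W → DirectedWalk p W q → walkSign G W ≡ proj₂ p S.* proj₂ q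
  directedWalk-sign {_ , s} []                    refl        = sym (S.s*s≡+ s)
  directedWalk-sign {_ , s} {_ , t} ((e , b) ∷ W) (leave , d) = begin
    sgn G e S.* walkSign G W
      ≡⟨ cong₂ S._*_ (sgn≡opposite[ω*ω] e b) (directedWalk-sign W d) ⟩
    S.opposite (ω O e b S.* h) S.* (h S.* t)
      ≡⟨ cong (λ x → S.opposite (x S.* h) S.* (h S.* t)) (cong proj₂ leave) ⟩
    S.opposite (S.opposite s S.* h) S.* (h S.* t)
      ≡⟨ opposite[opposite[s]*h]*[h*t]≡s*t s h t ⟩
    s S.* t ∎
    where
    open ≡-Reasoning
    h : Sign
    h = ω O e (not b)

  closedDirectedWalk⇒positiveClosedWalk : ∀ {p} W → DirectedWalk p W p → NonEmpty W →
    IsClosedWalk G (proj₁ p) W × walkSign G W ≡ S.+ × DirectedBy G O W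
  closedDirectedWalk⇒positiveClosedWalk {_ , s} W d nonEmptyW =
    (directedWalk⇒isWalk W d , nonEmptyW , directedWalk-endVertex W d) ,
    trans (directedWalk-sign W d) (S.s*s≡+ s) ,
    directedWalk⇒directedBy W d

  -- Edge multiplicities

  occ-++ : ∀ A B e → occ G (A ++ B) e ≡ occ G A e ℕ.+ occ G B e
  occ-++ []             B e = refl
  occ-++ ((e′ , _) ∷ A) B e with e′ ≟ e
  ... | yes _ = cong ℕ.suc (occ-++ A B e)
  ... | no  _ = occ-++ A B e

  occ-reverse : ∀ W e → occ G (reverseWalk W) e ≡ occ G W e
  occ-reverse []             e = refl
  occ-reverse ((e′ , b) ∷ W) e rewrite occ-++ (reverseWalk W) [ e′ , not b ] e | occ-reverse W e with e′ ≟ e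
  ... | yes _ = ℕ.+-comm (occ G W e) 1
  ... | no  _ = ℕ.+-identityʳ (occ G W e)

  occ-∷-self : ∀ e b W → occ G ((e , b) ∷ W) e ≡ ℕ.suc (occ G W e)
  occ-∷-self e b W with e ≟ e
  ... | yes _  = refl
  ... | no e≢e = ⊥-elim (e≢e refl)

  occ-head : ∀ e b W → 0 ℕ.< occ G ((e , b) ∷ W) e
  occ-head e b W = subst (0 ℕ.<_) (sym (occ-∷-self e b W)) (ℕ.s≤s ℕ.z≤n)

  occ-[]-other : ∀ e′ b e → e ≢ e′ → occ G [ e′ , b ] e ≡ 0
  occ-[]-other e′ b e e≢e′ with e′ ≟ e
  ... | yes e′≡e = ⊥-elim (e≢e′ (sym e′≡e))
  ... | no  _    = refl

  occ-≤-∷ : ∀ x W e → occ G W e ℕ.≤ occ G (x ∷ W) e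
  occ-≤-∷ x W e = subst (occ G W e ℕ.≤_) (sym (occ-++ [ x ] W e)) (ℕ.m≤n+m (occ G W e) (occ G [ x ] e))

  nonEmpty⇒occurs : ∀ W → NonEmpty W → ∃ λ e → 0 ℕ.< occ G W e
  nonEmpty⇒occurs ((e , b) ∷ W) _ = e , occ-head e b W

  occurs⇒split : ∀ W e → 0 ℕ.< occ G W e → ∃₂ λ A b → ∃ λ B → W ≡ A ++ (e , b) ∷ B
  occurs⇒split ((e′ , b) ∷ W) e occurs with e′ ≟ e
  ... | yes refl = [] , b , W , refl
  ... | no  _    =
    let A , b′ , B , W≡ = occurs⇒split W e occurs in (e′ , b) ∷ A , b′ , B , cong ((e′ , b) ∷_) W≡

  allEdgesIn-occurring : ∀ (P : Edge → Set) W → (∀ e → 0 ℕ.< occ G W e → P e) → AllEdgesIn G P W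
  allEdgesIn-occurring P []            _    = tt
  allEdgesIn-occurring P ((e , b) ∷ W) occP =
    occP e (occ-head e b W) ,
    allEdgesIn-occurring P W (λ e′ occurs → occP e′ (ℕ.<-≤-trans occurs (occ-≤-∷ (e , b) W e′)))

  Within : (Edge → ℕ) → Walk → Set
  Within r W = ∀ e → occ G W e ℕ.≤ r e

  residual : (Edge → ℕ) → Walk → Edge → ℕ
  residual r W e = r e ∸ occ G W e

  slack : (Edge → ℕ) → Walk → ℕ
  slack r W = ℕΣ.sum (residual r W)

  within-[] : ∀ {r e} b → 0 ℕ.< r e → Within r [ e , b ]
  within-[] {e = e} b 0<re e′ with e ≟ e′
  ... | yes refl = 0<re
  ... | no  _    = ℕ.z≤n

  within-extend : ∀ {r} W X W′ → (∀ e → occ G W′ e ≡ occ G W e ℕ.+ occ G X e) →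
                  Within r W → Within (residual r W) X → Within r W′
  within-extend {r} W X W′ occ≡ withinW withinX e = begin
    occ G W′ e                        ≡⟨ occ≡ e ⟩
    occ G W e ℕ.+ occ G X e           ≤⟨ ℕ.+-monoʳ-≤ (occ G W e) (withinX e) ⟩
    occ G W e ℕ.+ (r e ∸ occ G W e)   ≡⟨ ℕ.m+[n∸m]≡n (withinW e) ⟩
    r e                               ∎
    where open ℕ.≤-Reasoning

  slack-shrinks : ∀ r W X W′ → (∀ e → occ G W′ e ≡ occ G W e ℕ.+ occ G X e) → NonEmpty X →
                  Within r W′ → slack r W′ ℕ.< slack r W
  slack-shrinks r W X W′ occ≡ nonEmptyX withinW′ =
    sum-mono-< (λ e → ℕ.∸-monoʳ-≤ (r e) (W≤W′ e)) e (ℕ.∸-monoʳ-< W<W′ (withinW′ e))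
    where
    W≤W′ : ∀ e → occ G W e ℕ.≤ occ G W′ e
    W≤W′ e = subst (occ G W e ℕ.≤_) (sym (occ≡ e)) (ℕ.m≤m+n (occ G W e) (occ G X e))
    e : Edge
    e = proj₁ (nonEmpty⇒occurs X nonEmptyX)
    W<W′ : occ G W e ℕ.< occ G W′ e
    W<W′ = subst (occ G W e ℕ.<_) (sym (occ≡ e)) (ℕ.m<m+n (occ G W e) (proj₂ (nonEmpty⇒occurs X nonEmptyX)))

  no-residual⇒≤occ : ∀ r W e → ¬ 0 ℕ.< residual r W e → r e ℕ.≤ occ G W e
  no-residual⇒≤occ r W e not-free = ℕ.m∸n≡0⇒m≤n (ℕ.n≤0⇒n≡0 (ℕ.≮⇒≥ not-free))

  -- Boundaries of walk flows

  ∂ : (Edge → ℤ) → Vertex → ℤ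
  ∂ = boundary G O

  charge : Port → Vertex → ℤ
  charge (v , s) y with v ≟ y
  ... | yes _ = signℤ s
  ... | no  _ = 0ℤ

  charge-self : ∀ y s → charge (y , s) y ≡ signℤ s
  charge-self y s with y ≟ y
  ... | yes _  = refl
  ... | no y≢y = ⊥-elim (y≢y refl)

  charge-cancel : ∀ p y → charge (oppositePort p) y + charge p y ≡ 0ℤ
  charge-cancel (v , s) y with v ≟ y
  charge-cancel (v , S.+) y | yes _ = refl
  charge-cancel (v , S.-) y | yes _ = refl
  ... | no _ = refl

  endContrib≡charge* : ∀ g y e b → endContrib G O g y e b ≡ charge (endPort e b) y * g e
  endContrib≡charge* g y e b with ends G e b ≟ y
  ... | yes _ = refl
  ... | no  _ = refl

  incidence : Edge → Vertex → ℤ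
  incidence e y = charge (endPort e false) y + charge (endPort e true) y

  incidence-from : ∀ e b y → incidence e y ≡ charge (endPort e b) y + charge (endPort e (not b)) y
  incidence-from e false y = refl
  incidence-from e true  y = ℤ.+-comm (charge (endPort e false) y) (charge (endPort e true) y)

  boundary≡incidence-sum : ∀ g y → ∂ g y ≡ ℤΣ.sum (λ e → incidence e y * g e)
  boundary≡incidence-sum g y = trans (sumFin≡sum (nE G) _) (ℤΣ.sum-cong-≗ λ e →
    trans (cong₂ _+_ (endContrib≡charge* g y e false) (endContrib≡charge* g y e true))
          (sym (ℤ.*-distribʳ-+ (g e) (charge (endPort e false) y) (charge (endPort e true) y))))

  boundary-cong : ∀ {g h} → (∀ e → g e ≡ h e) → ∀ y → ∂ g y ≡ ∂ h y
  boundary-cong {g} {h} g≗h y = begin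
    ∂ g y                                   ≡⟨ boundary≡incidence-sum g y ⟩
    ℤΣ.sum (λ e → incidence e y * g e)      ≡⟨ ℤΣ.sum-cong-≗ (λ e → cong (incidence e y *_) (g≗h e)) ⟩
    ℤΣ.sum (λ e → incidence e y * h e)      ≡⟨ boundary≡incidence-sum h y ⟨
    ∂ h y                                   ∎
    where open ≡-Reasoning

  boundary-+ : ∀ g h y → ∂ (λ e → g e + h e) y ≡ ∂ g y + ∂ h y
  boundary-+ g h y = begin
    ∂ (λ e → g e + h e) y
      ≡⟨ boundary≡incidence-sum _ y ⟩
    ℤΣ.sum (λ e → incidence e y * (g e + h e))
      ≡⟨ ℤΣ.sum-cong-≗ (λ e → ℤ.*-distribˡ-+ (incidence e y) (g e) (h e)) ⟩
    ℤΣ.sum (λ e → ηg e + ηh e)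
      ≡⟨ ℤΣ.∑-distrib-+ ηg ηh ⟩
    ℤΣ.sum ηg + ℤΣ.sum ηh
      ≡⟨ cong₂ _+_ (boundary≡incidence-sum g y) (boundary≡incidence-sum h y) ⟨
    ∂ g y + ∂ h y ∎
    where
    open ≡-Reasoning
    ηg ηh : Edge → ℤ
    ηg e = incidence e y * g e
    ηh e = incidence e y * h e

  walkFlow : Walk → Edge → ℤ
  walkFlow W e = + occ G W e

  boundary-walkFlow-[] : ∀ y → ∂ (walkFlow []) y ≡ 0ℤ
  boundary-walkFlow-[] y = trans (boundary≡incidence-sum _ y)
    (trans (ℤΣ.sum-cong-≗ (λ e → ℤ.*-zeroʳ (incidence e y))) (ℤΣ.sum-replicate-zero (nE G)))

  boundary-walkFlow-single : ∀ e b y → ∂ (walkFlow [ e , b ]) y ≡ incidence e y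
  boundary-walkFlow-single e b y = begin
    ∂ (walkFlow [ e , b ]) y                                ≡⟨ boundary≡incidence-sum _ y ⟩
    ℤΣ.sum (λ e′ → incidence e′ y * walkFlow [ e , b ] e′)  ≡⟨ sum-δ _ e vanish ⟩
    incidence e y * walkFlow [ e , b ] e                    ≡⟨ cong (λ n → incidence e y * + n) (occ-∷-self e b []) ⟩
    incidence e y * + 1                                     ≡⟨ ℤ.*-identityʳ (incidence e y) ⟩
    incidence e y                                           ∎
    where
    open ≡-Reasoning
    vanish : ∀ e′ → e′ ≢ e → incidence e′ y * walkFlow [ e , b ] e′ ≡ 0ℤ
    vanish e′ e′≢e =
      trans (cong (λ n → incidence e′ y * + n) (occ-[]-other e b e′ e′≢e)) (ℤ.*-zeroʳ (incidence e′ y))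

  boundary-walkFlow-∷ : ∀ e b W y → ∂ (walkFlow ((e , b) ∷ W)) y ≡ incidence e y + ∂ (walkFlow W) y
  boundary-walkFlow-∷ e b W y = begin
    ∂ (walkFlow ((e , b) ∷ W)) y
      ≡⟨ boundary-cong (λ e′ → cong +_ (occ-++ [ e , b ] W e′)) y ⟩
    ∂ (λ e′ → walkFlow [ e , b ] e′ + walkFlow W e′) y
      ≡⟨ boundary-+ (walkFlow [ e , b ]) (walkFlow W) y ⟩
    ∂ (walkFlow [ e , b ]) y + ∂ (walkFlow W) y
      ≡⟨ cong (_+ ∂ (walkFlow W) y) (boundary-walkFlow-single e b y) ⟩
    incidence e y + ∂ (walkFlow W) y ∎
    where open ≡-Reasoning

  private
    cancel-middle : ∀ a c c′ d → c′ + c ≡ 0ℤ → (a + c) + (c′ + d) ≡ a + d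
    cancel-middle a c c′ d c′+c≡0 = begin
      (a + c) + (c′ + d)   ≡⟨ ℤ.+-assoc a c (c′ + d) ⟩
      a + (c + (c′ + d))   ≡⟨ cong (_+_ a) (ℤ.+-assoc c c′ d) ⟨
      a + ((c + c′) + d)   ≡⟨ cong (λ x → a + (x + d)) (trans (ℤ.+-comm c c′) c′+c≡0) ⟩
      a + (0ℤ + d)         ≡⟨ cong (_+_ a) (ℤ.+-identityˡ d) ⟩
      a + d                ∎
      where open ≡-Reasoning

  boundary-walkFlow : ∀ {p q} W → DirectedWalk p W q → ∀ y →
                      ∂ (walkFlow W) y ≡ charge (oppositePort p) y + charge q y
  boundary-walkFlow {p}     []            refl        y =
    trans (boundary-walkFlow-[] y) (sym (charge-cancel p y))
  boundary-walkFlow {p} {q} ((e , b) ∷ W) (leave , d) y = begin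
    ∂ (walkFlow ((e , b) ∷ W)) y
      ≡⟨ boundary-walkFlow-∷ e b W y ⟩
    incidence e y + ∂ (walkFlow W) y
      ≡⟨ cong₂ _+_ (incidence-from e b y) (boundary-walkFlow W d y) ⟩
    (charge (endPort e b) y + charge arrival y) + (charge (oppositePort arrival) y + charge q y)
      ≡⟨ cancel-middle (charge (endPort e b) y) (charge arrival y) (charge (oppositePort arrival) y) (charge q y)
                       (charge-cancel arrival y) ⟩
    charge (endPort e b) y + charge q y
      ≡⟨ cong (λ x → charge x y + charge q y) leave ⟩
    charge (oppositePort p) y + charge q y ∎
    where
    open ≡-Reasoning
    arrival : Port
    arrival = endPort e (not b)

  boundary-residual : ∀ {r p q} W → IsFlow G O (+_ ∘ r) → DirectedWalk p W q → Within r W → ∀ y →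
                      ∂ (+_ ∘ residual r W) y ≡ - (charge (oppositePort p) y + charge q y)
  boundary-residual {r} {p} {q} W r-isFlow d withinW y = begin
    ∂ (+_ ∘ residual r W) y                       ≡⟨ inverseˡ-unique _ _ residual+walk≡0 ⟩
    - ∂ (walkFlow W) y                            ≡⟨ cong -_ (boundary-walkFlow W d y) ⟩
    - (charge (oppositePort p) y + charge q y)    ∎
    where
    open ≡-Reasoning
    residual+walk≡0 : ∂ (+_ ∘ residual r W) y + ∂ (walkFlow W) y ≡ 0ℤ
    residual+walk≡0 = begin
      ∂ (+_ ∘ residual r W) y + ∂ (walkFlow W) y   ≡⟨ boundary-+ (+_ ∘ residual r W) (walkFlow W) y ⟨
      ∂ (λ e → + (residual r W e ℕ.+ occ G W e)) y ≡⟨ boundary-cong (λ e → cong +_ (ℕ.m∸n+n≡m (withinW e))) y ⟩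
      ∂ (+_ ∘ r) y                                 ≡⟨ r-isFlow y ⟩
      0ℤ                                           ∎

  residual-isFlow : ∀ {r p} W → IsFlow G O (+_ ∘ r) → DirectedWalk p W p → Within r W →
                    IsFlow G O (+_ ∘ residual r W)
  residual-isFlow {p = p} W r-isFlow d withinW y =
    trans (boundary-residual W r-isFlow d withinW y) (cong -_ (charge-cancel p y))

  private
    signs-agree : ∀ σ s n → 0ℤ < signℤ σ * (signℤ s * + n) → s ≡ σ × 0 ℕ.< n
    signs-agree S.+ S.+ (ℕ.suc n) _ = refl , ℕ.s≤s ℕ.z≤n
    signs-agree S.- S.- (ℕ.suc n) _ = refl , ℕ.s≤s ℕ.z≤n
    signs-agree S.+ S.- (ℕ.suc n) ()
    signs-agree S.- S.+ (ℕ.suc n) ()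
    signs-agree S.+ S.+ ℕ.zero    (ℤ.+<+ ())
    signs-agree S.+ S.- ℕ.zero    (ℤ.+<+ ())
    signs-agree S.- S.+ ℕ.zero    (ℤ.+<+ ())
    signs-agree S.- S.- ℕ.zero    (ℤ.+<+ ())

  charge-positive : ∀ σ p x n → 0ℤ < signℤ σ * (charge p x * + n) → p ≡ (x , σ) × 0 ℕ.< n
  charge-positive σ (v , s) x n pos with v ≟ x
  ... | yes refl = let s≡σ , 0<n = signs-agree σ s n pos in cong (v ,_) s≡σ , 0<n
  ... | no  _    = ⊥-elim (ℤ.<-irrefl refl (subst (0ℤ <_) (ℤ.*-zeroʳ (signℤ σ)) pos))

  private
    endTerm : ℤ → (Edge → ℕ) → Vertex → Edge → Bool → ℤ
    endTerm c g x e b = c * (charge (endPort e b) x * + g e)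

    scaled-boundary : ∀ c g x → c * ∂ (+_ ∘ g) x ≡ ℤΣ.sum (λ e → endTerm c g x e false + endTerm c g x e true)
    scaled-boundary c g x = begin
      c * ∂ (+_ ∘ g) x                                  ≡⟨ cong (c *_) (boundary≡incidence-sum _ x) ⟩
      c * ℤΣ.sum (λ e → incidence e x * + g e)          ≡⟨ ℤΣ.*-distribˡ-sum c (λ e → incidence e x * + g e) ⟩
      ℤΣ.sum (λ e → c * (incidence e x * + g e))        ≡⟨ ℤΣ.sum-cong-≗ split-ends ⟩
      ℤΣ.sum (λ e → endTerm c g x e false + endTerm c g x e true) ∎
      where
      open ≡-Reasoning
      split-ends : ∀ e → c * (incidence e x * + g e) ≡ endTerm c g x e false + endTerm c g x e true
      split-ends e =
        trans (cong (c *_) (ℤ.*-distribʳ-+ (+ g e) (charge (endPort e false) x) (charge (endPort e true) x)))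
              (ℤ.*-distribˡ-+ c _ _)

  outflow : ∀ (g : Edge → ℕ) σ x → 0ℤ < signℤ σ * ∂ (+_ ∘ g) x →
            ∃₂ λ e b → endPort e b ≡ (x , σ) × 0 ℕ.< g e
  outflow g σ x pos with sum-positive _ (subst (0ℤ <_) (scaled-boundary (signℤ σ) g x) pos)
  ... | e , pos-e with positive-summand (endTerm (signℤ σ) g x e false) _ pos-e
  ... | inj₁ pos-false = e , false , charge-positive σ (endPort e false) x (g e) pos-false
  ... | inj₂ pos-true  = e , true  , charge-positive σ (endPort e true)  x (g e) pos-true

  unclosed-charge-positive : ∀ p x s → (x , s) ≢ p →
                             0ℤ < signℤ (S.opposite s) * - (charge (oppositePort p) x + charge (x , s) x)
  unclosed-charge-positive (v , t) x s q≢p rewrite charge-self x s with v ≟ x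
  unclosed-charge-positive (v , S.+) x S.+ q≢p | yes refl = ⊥-elim (q≢p refl)
  unclosed-charge-positive (v , S.-) x S.- q≢p | yes refl = ⊥-elim (q≢p refl)
  unclosed-charge-positive (v , S.+) x S.- q≢p | yes refl = ℤ.+<+ (ℕ.s≤s ℕ.z≤n)
  unclosed-charge-positive (v , S.-) x S.+ q≢p | yes refl = ℤ.+<+ (ℕ.s≤s ℕ.z≤n)
  unclosed-charge-positive (v , t)   x S.+ q≢p | no _     = ℤ.+<+ (ℕ.s≤s ℕ.z≤n)
  unclosed-charge-positive (v , t)   x S.- q≢p | no _     = ℤ.+<+ (ℕ.s≤s ℕ.z≤n)

  record ClosedWalkWithin (r : Edge → ℕ) (p : Port) : Set where
    constructor closedWalk
    field
      walk     : Walk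
      directed : DirectedWalk p walk p
      nonEmpty : NonEmpty walk
      within   : Within r walk
  open ClosedWalkWithin public

  module Greedy (r : Edge → ℕ) (r-isFlow : IsFlow G O (+_ ∘ r)) where

    outgoingEdge : ∀ {p q} T → DirectedWalk p T q → Within r T → q ≢ p →
                   ∃₂ λ e b → endPort e b ≡ oppositePort q × 0 ℕ.< residual r T e
    outgoingEdge {p} {x , s} T d withinT q≢p =
      outflow (residual r T) (S.opposite s) x
        (subst (λ z → 0ℤ < signℤ (S.opposite s) * z) (sym (boundary-residual T r-isFlow d withinT x))
               (unclosed-charge-positive p x s q≢p))

    extend : ∀ {p q} T → DirectedWalk p T q → NonEmpty T → Within r T → Acc ℕ._<_ (slack r T) →
             ClosedWalkWithin r p
    extend {p} {q} T d nonEmptyT withinT (acc shorter) with ≡-dec _≟_ S._≟_ q p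
    ... | yes refl = closedWalk T d nonEmptyT withinT
    ... | no q≢p with outgoingEdge T d withinT q≢p
    ... | e , b , leave , free =
      extend (T ∷ʳ (e , b)) (directedWalk-++ T d (leave , refl)) (nonEmpty-∷ʳ T (e , b)) withinT′
             (shorter (slack-shrinks r T [ e , b ] (T ∷ʳ (e , b)) (occ-++ T [ e , b ]) tt withinT′))
      where
      withinT′ : Within r (T ∷ʳ (e , b))
      withinT′ = within-extend T [ e , b ] (T ∷ʳ (e , b)) (occ-++ T [ e , b ]) withinT (within-[] b free)

    closedWalkThrough : ∀ e b → 0 ℕ.< r e → ClosedWalkWithin r (oppositePort (endPort e b))
    closedWalkThrough e b 0<re =
      extend [ e , b ] (sym (oppositePort-involutive (endPort e b)) , refl) tt (within-[] b 0<re)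
             (ℕ.<-wellFounded _)

  -- Splicing closed walks

  reverseClosedWalk : ∀ {r p} → ClosedWalkWithin r p → ClosedWalkWithin r (oppositePort p)
  reverseClosedWalk (closedWalk W d nonEmptyW withinW) =
    closedWalk (reverseWalk W) (directedWalk-reverse W d) (nonEmpty-reverse W nonEmptyW)
               (λ e → subst (ℕ._≤ _) (sym (occ-reverse W e)) (withinW e))

  closedWalk-withSign : ∀ {r v s} t → ClosedWalkWithin r (v , s) → ClosedWalkWithin r (v , t)
  closedWalk-withSign {s = S.+} S.+ C = C
  closedWalk-withSign {s = S.-} S.- C = C
  closedWalk-withSign {s = S.+} S.- C = reverseClosedWalk C
  closedWalk-withSign {s = S.-} S.+ C = reverseClosedWalk C

  PassesThrough : Port → Walk → Port → Set
  PassesThrough p W q = ∃₂ λ A B → W ≡ A ++ B × DirectedWalk p A q × DirectedWalk q B p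

  splice : ∀ {r p q} (C : ClosedWalkWithin r p) → PassesThrough p (walk C) q →
           (D : ClosedWalkWithin (residual r (walk C)) q) →
           Σ (ClosedWalkWithin r q) λ C′ → slack r (walk C′) ℕ.< slack r (walk C)
  splice {r} C (A , B , W≡A++B , dA , dB) D =
    closedWalk W′ (directedWalk-++ (walk D) (directed D) (directedWalk-++ B dB dA))
               (nonEmpty-++ (walk D) (nonEmpty D)) withinW′ ,
    slack-shrinks r (walk C) (walk D) W′ occ≡ (nonEmpty D) withinW′
    where
    W′ : Walk
    W′ = walk D ++ (B ++ A)
    occ≡ : ∀ e → occ G W′ e ≡ occ G (walk C) e ℕ.+ occ G (walk D) e
    occ≡ e = begin
      occ G W′ e                   ≡⟨ occ-++ (walk D) (B ++ A) e ⟩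
      d ℕ.+ occ G (B ++ A) e       ≡⟨ cong (d ℕ.+_) (occ-++ B A e) ⟩
      d ℕ.+ (occ G B e ℕ.+ a)      ≡⟨ ℕ.+-comm d _ ⟩
      (occ G B e ℕ.+ a) ℕ.+ d      ≡⟨ cong (ℕ._+ d) (ℕ.+-comm (occ G B e) a) ⟩
      (a ℕ.+ occ G B e) ℕ.+ d      ≡⟨ cong (ℕ._+ d) (occ-++ A B e) ⟨
      occ G (A ++ B) e ℕ.+ d       ≡⟨ cong (λ W → occ G W e ℕ.+ d) W≡A++B ⟨
      occ G (walk C) e ℕ.+ d       ∎
      where
      open ≡-Reasoning
      a d : ℕ
      a = occ G A e
      d = occ G (walk D) e
    withinW′ : Within r W′
    withinW′ = within-extend (walk C) (walk D) W′ occ≡ (within C) (within D)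

  Visits : Port → Walk → Vertex → Set
  Visits p W u = ∃ λ q → proj₁ q ≡ u × PassesThrough p W q

  visits-ends : ∀ {p} W → DirectedWalk p W p → ∀ e → 0 ℕ.< occ G W e → ∀ b → Visits p W (ends G e b)
  visits-ends W d e occurs with occurs⇒split W e occurs
  ... | A , b′ , B , refl with directedWalk-++⁻ A d
  ... | q , dA , (leave , dB) = bool-cover (λ b → Visits _ W (ends G e b)) b′ visitsTail visitsHead
    where
    visitsTail : Visits _ W (ends G e b′)
    visitsTail = q , sym (cong proj₁ leave) , A , (e , b′) ∷ B , refl , dA , leave , dB
    visitsHead : Visits _ W (ends G e (not b′))
    visitsHead = endPort e (not b′) , refl , A ∷ʳ (e , b′) , B , sym (∷ʳ-++ A (e , b′) B) ,
                 directedWalk-++ A dA (leave , refl) , dB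

  module Completion (f : Edge → ℤ) (f-isFlow : IsFlow G O f) (f≥0 : ∀ e → 0ℤ ≤ f e)
                    (connected : SuppConnected G f) where

    ∣f∣ : Edge → ℕ
    ∣f∣ e = ℤ.∣ f e ∣

    +∣f∣≡f : ∀ e → + ∣f∣ e ≡ f e
    +∣f∣≡f e = ℤ.0≤i⇒+∣i∣≡i (f≥0 e)

    ∣f∣-isFlow : IsFlow G O (+_ ∘ ∣f∣)
    ∣f∣-isFlow y = trans (boundary-cong +∣f∣≡f y) (f-isFlow y)

    inSupport : ∀ {e} → 0 ℕ.< ∣f∣ e → InSuppE G f e
    inSupport 0<∣fe∣ fe≡0 = ℕ.n>0⇒n≢0 0<∣fe∣ (cong ℤ.∣_∣ fe≡0)

    positive : ∀ {e} → InSuppE G f e → 0 ℕ.< ∣f∣ e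
    positive fe≢0 = ℕ.n≢0⇒n>0 (fe≢0 ∘ ℤ.∣i∣≡0⇒i≡0)

    -- An edge of Σ(f) with no residual occurs in C, so both of its ends lie on C:
    -- the walk P cannot leave C before it meets an edge with positive residual.
    unsaturatedEdgeOn : ∀ {p} (C : ClosedWalkWithin ∣f∣ p) {u} → Visits p (walk C) u →
                        ∀ P → IsWalkFrom G u P → AllEdgesIn G (InSuppE G f) P →
                        ∀ {e₀} b₀ → ends G e₀ b₀ ≡ endVertex G u P → 0 ℕ.< residual ∣f∣ (walk C) e₀ →
                        ∃₂ λ e b → 0 ℕ.< residual ∣f∣ (walk C) e × Visits p (walk C) (ends G e b)
    unsaturatedEdgeOn C visitsU [] _ _ b₀ atEnd free₀ =
      _ , b₀ , free₀ , subst (Visits _ (walk C)) (sym atEnd) visitsU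
    unsaturatedEdgeOn C visitsU ((e , b) ∷ P) (leave , walkP) (inSupp , inSuppP) b₀ atEnd free₀
      with 0 ℕ.<? residual ∣f∣ (walk C) e
    ... | yes free = e , b , free , subst (Visits _ (walk C)) (sym leave) visitsU
    ... | no  not-free =
      unsaturatedEdgeOn C (visits-ends (walk C) (directed C) e occurs (not b)) P walkP inSuppP b₀ atEnd free₀
      where
      occurs : 0 ℕ.< occ G (walk C) e
      occurs = ℕ.<-≤-trans (positive inSupp) (no-residual⇒≤occ ∣f∣ (walk C) e not-free)

    enlarge : ∀ {p} (C : ClosedWalkWithin ∣f∣ p) → ∃ (λ e → 0 ℕ.< residual ∣f∣ (walk C) e) →
              ∃ λ q → Σ (ClosedWalkWithin ∣f∣ q) λ C′ → slack ∣f∣ (walk C′) ℕ.< slack ∣f∣ (walk C)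
    enlarge C (e₀ , free₀) =
      let e₁ , occurs₁ = nonEmpty⇒occurs (walk C) (nonEmpty C)
          P , walkP , endP , inSuppP = connected (ends G e₁ false) (ends G e₀ false)
            (e₁ , false , inSupport (ℕ.<-≤-trans occurs₁ (within C e₁)) , refl)
            (e₀ , false , inSupport (ℕ.<-≤-trans free₀ (ℕ.m∸n≤m (∣f∣ e₀) (occ G (walk C) e₀))) , refl)
          e , b , free , q , atQ , throughQ =
            unsaturatedEdgeOn C (visits-ends (walk C) (directed C) e₁ occurs₁ false)
                              P walkP inSuppP false (sym endP) free₀
          D = Greedy.closedWalkThrough (residual ∣f∣ (walk C)) residual-isFlowC e b free
      in q , splice C throughQ (closedWalk-withSign (proj₂ q) (subst (ClosedWalkAt e b) (sym atQ) D))
      where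
      residual-isFlowC : IsFlow G O (+_ ∘ residual ∣f∣ (walk C))
      residual-isFlowC = residual-isFlow (walk C) ∣f∣-isFlow (directed C) (within C)
      ClosedWalkAt : Edge → Bool → Vertex → Set
      ClosedWalkAt e b v = ClosedWalkWithin (residual ∣f∣ (walk C)) (v , S.opposite (ω O e b))

    complete : ∀ {p} (C : ClosedWalkWithin ∣f∣ p) → Acc ℕ._<_ (slack ∣f∣ (walk C)) →
               ∃ λ q → Σ (ClosedWalkWithin ∣f∣ q) λ C′ → ∀ e → occ G (walk C′) e ≡ ∣f∣ e
    complete C (acc smaller) with any? (λ e → 0 ℕ.<? residual ∣f∣ (walk C) e)
    ... | yes unsaturated = let q , C′ , shrinks = enlarge C unsaturated in complete C′ (smaller shrinks)
    ... | no  none-free   =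
      _ , C , λ e → ℕ.≤-antisym (within C e) (no-residual⇒≤occ ∣f∣ (walk C) e (none-free ∘ (e ,_)))

    eulerianWalk : ∃ (λ e → InSuppE G f e) →
                   ∃ λ q → Σ (ClosedWalkWithin ∣f∣ q) λ C → ∀ e → occ G (walk C) e ≡ ∣f∣ e
    eulerianWalk (e₀ , inSupp₀) =
      complete (Greedy.closedWalkThrough ∣f∣ ∣f∣-isFlow e₀ false (positive inSupp₀)) (ℕ.<-wellFounded _)

proposition3p2 : (G : SignedGraph) (O : Orientation G) (f : Fin (nE G) → ℤ) →
    IsFlow G O f →
    (∀ e → 0ℤ ≤ f e) →
    Σ (Fin (nE G)) (λ e → ¬ (f e ≡ 0ℤ)) →
    SuppConnected G f →
    Σ (Fin (nV G)) λ v₀ → Σ (List (Step G)) λ W →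
      IsClosedWalk G v₀ W × AllEdgesIn G (InSuppE G f) W ×
      walkSign G W ≡ S.+ × DirectedBy G O W ×
      (∀ e → + (occ G W e) ≡ f e)
proposition3p2 G O f f-isFlow f≥0 nonzero connected =
  let q , C , exact = eulerianWalk nonzero
      closed , signPositive , directedBy =
        closedDirectedWalk⇒positiveClosedWalk (walk C) (directed C) (nonEmpty C)
  in proj₁ q , walk C , closed ,
     allEdgesIn-occurring _ (walk C) (λ e occurs → inSupport (subst (0 ℕ.<_) (exact e) occurs)) ,
     signPositive , directedBy ,
     λ e → trans (cong +_ (exact e)) (+∣f∣≡f e)
  where
  open DirectedWalks G O
  open Completion f f-isFlow f≥0 connected
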